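{- Let $G$ be a connected graph. Then the following statements are equivalent: (B1) $G$ is $\{\text{pan}, \text{diamond}\}$-free; (B2) every DFS ordering of $G$ is a LexDFS ordering of $G$; (B3) every BFS ordering of $G$ is a LexBFS ordering of $G$; (B4) every graph search ordering of $G$ is an MNS ordering of $G$.
   Context: All graphs are finite and simple. For an ordering $\sigma$ of $V(G)$ write $x<_\sigma y$ if $x$ precedes $y$. A graph search ordering of $G$ is an ordering of $V(G)$ such that every prefix induces a connected subgraph. In each of the following, the condition is required for all $a<_\sigma b<_\sigma c$ with $ac\in E(G)$ and $ab\notin E(G)$: $\sigma$ is a BFS ordering if there is $d$ with $d<_\sigma a$ and $db\in E(G)$; a DFS ordering if there is $d$ with $a<_\sigma d<_\sigma b$ and $db\in E(G)$; a LexBFS ordering if there is $d$ with $d<_\sigma a$, $db\in E(G)$, $dc\notin E(G)$; a LexDFS ordering if there is $d$ with $a<_\sigma d<_\sigma b$, $db\in E(G)$, $dc\notin E(G)$; an MNS ordering if there is $d$ with $d<_\sigma b$, $db\in E(G)$, $dc\notin E(G)$. For $k\ge 3$, a $k$-pan is a cycle of length $k$ together with one extra vertex adjacent to exactly one vertex of the cycle; a pan is a $k$-pan for some $k\ge3$, and pan-free means containing no $k$-pan as an induced subgraph for any $k\ge 3$. The diamond is $K_4$ minus one edge. $\{\text{pan},\text{diamond}\}$-free means no induced pan and no induced diamond. -}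

module Defs where

open import Data.Nat using (ℕ; zero; suc; _≤_)
import Data.Nat as ℕ
open import Data.Fin using (Fin; toℕ)
import Data.Fin as F
open import Data.Fin.Permutation using (Permutation′; _⟨$⟩ʳ_; _⟨$⟩ˡ_)
open import Data.Bool using (Bool; true; false)
open import Data.Product using (Σ; ∃; ∃-syntax; _×_; _,_)
open import Data.Sum using (_⊎_)
open import Data.Unit using (⊤)
open import Relation.Nullary using (¬_)
open import Relation.Binary.PropositionalEquality using (_≡_; _≢_)
open import Function.Definitions using (Injective)
open import Function.Bundles using (_⇔_)

record Graph (n : ℕ) : Set where
  field
    adj    : Fin n → Fin n → Bool
    sym    : ∀ x y → adj x y ≡ adj y x
    irrefl : ∀ x → adj x x ≡ false

module _ {n : ℕ} (G : Graph n) where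
  open Graph G

  E : Fin n → Fin n → Set
  E x y = adj x y ≡ true

  data WalkIn (S : Fin n → Set) : Fin n → Fin n → Set where
    here : ∀ {u} → S u → WalkIn S u u
    step : ∀ {u v w} → S u → E u v → WalkIn S v w → WalkIn S u w

  ConnectedIn : (Fin n → Set) → Set
  ConnectedIn S = ∀ u v → S u → S v → WalkIn S u v

  Connected : Set
  Connected = ConnectedIn (λ _ → ⊤)

  InducedCopy : (m : ℕ) → (Fin m → Fin m → Set) → Set
  InducedCopy m H = Σ (Fin m → Fin n) λ f →
    Injective _≡_ _≡_ f × (∀ i j → E (f i) (f j) ⇔ H i j)

-- k-pan on Fin (suc k): vertices 0..k-1 form the cycle (i ~ i+1, and 0 ~ k-1),
-- vertex k is pendant, adjacent to vertex 0 only.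
PanE : (k : ℕ) → Fin (suc k) → Fin (suc k) → Set
PanE k i j =
  (toℕ i ℕ.< k × toℕ j ℕ.< k ×
     (suc (toℕ i) ≡ toℕ j ⊎ suc (toℕ j) ≡ toℕ i ⊎
      (toℕ i ≡ 0 × suc (toℕ j) ≡ k) ⊎ (toℕ j ≡ 0 × suc (toℕ i) ≡ k)))
  ⊎ (toℕ i ≡ k × toℕ j ≡ 0) ⊎ (toℕ i ≡ 0 × toℕ j ≡ k)

DiamondE : Fin 4 → Fin 4 → Set
DiamondE i j = i ≢ j × ¬ ((toℕ i ≡ 2 × toℕ j ≡ 3) ⊎ (toℕ i ≡ 3 × toℕ j ≡ 2))

module _ {n : ℕ} (G : Graph n) where

  PanDiamondFree : Set
  PanDiamondFree =
    (∀ k → 3 ≤ k → ¬ InducedCopy G (suc k) (PanE k)) × ¬ InducedCopy G 4 DiamondE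

  -- Orderings: σ ⟨$⟩ʳ i is the vertex at position i; pos σ v is the position of v.
  Ordering : Set
  Ordering = Permutation′ n

  pos : Ordering → Fin n → Fin n
  pos σ v = σ ⟨$⟩ˡ v

  _<[_]_ : Fin n → Ordering → Fin n → Set
  x <[ σ ] y = pos σ x F.< pos σ y

  IsSearch : Ordering → Set
  IsSearch σ = ∀ (k : ℕ) → ConnectedIn G (λ v → toℕ (pos σ v) ℕ.< k)

  Rule : Ordering → (Fin n → Fin n → Fin n → Set) → Set
  Rule σ P = ∀ a b c → a <[ σ ] b → b <[ σ ] c → E G a c → ¬ E G a b → P a b c

  IsBFS : Ordering → Set
  IsBFS σ = IsSearch σ × Rule σ (λ a b c → ∃[ d ] (d <[ σ ] a × E G d b))

  IsDFS : Ordering → Set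
  IsDFS σ = IsSearch σ × Rule σ (λ a b c → ∃[ d ] (a <[ σ ] d × d <[ σ ] b × E G d b))

  IsLexBFS : Ordering → Set
  IsLexBFS σ = IsSearch σ ×
    Rule σ (λ a b c → ∃[ d ] (d <[ σ ] a × E G d b × ¬ E G d c))

  IsLexDFS : Ordering → Set
  IsLexDFS σ = IsSearch σ ×
    Rule σ (λ a b c → ∃[ d ] (a <[ σ ] d × d <[ σ ] b × E G d b × ¬ E G d c))

  IsMNS : Ordering → Set
  IsMNS σ = IsSearch σ ×
    Rule σ (λ a b c → ∃[ d ] (d <[ σ ] b × E G d b × ¬ E G d c))

{-# OPTIONS --safe #-}
module Submission where

-- Call a path b – d – c – a with ab ∉ E, together with a walk of length ℓ from d to a
-- avoiding b and c, a configuration (d and a, or b and c, may be adjacent). An induced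
-- pan or diamond contains one. Conversely, take one with ℓ minimal: a vertex other than
-- d that is reached from d by a shorter walk avoiding b and c is adjacent to neither b
-- nor c, as otherwise there would be a shorter configuration. So the walk, c and b
-- induce a pan, or a diamond if ℓ = 1 and bc ∈ E.
--
-- If a < b < c in a search ordering, ac ∈ E, ab ∉ E, and d < b is adjacent to b, then
-- the prefix before b contains a walk from d to a. Without configurations dc ∉ E, which
-- is all that LexDFS, LexBFS and MNS add to DFS, BFS and graph search.
--
-- In a minimal configuration the walk from a to d followed by b is the beginning of a
-- DFS ordering, and it violates both LexDFS and MNS. For BFS, start at the middle of
-- the walk and break ties in favour of its half leading to d (ℓ even) or to a (ℓ odd).
-- Then d is the earliest neighbour of both b and c, and a precedes them. Let y be the
-- first vertex adjacent to exactly one of b and c; both may come next once y and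
-- everything before b and c has been visited, and visiting the non-neighbour of y first
-- violates LexBFS.

open import Defs
open import Data.Bool using (true)
import Data.Bool.Properties as Bool
open import Data.Empty using (⊥; ⊥-elim)
open import Data.Fin using (Fin; zero; suc; toℕ; fromℕ<)
open import Data.Fin.Patterns using (0F; 1F; 2F; 3F)
open import Data.Fin.Permutation using (permutation; inverseʳ; _⟨$⟩ʳ_)
open import Data.Fin.Properties using (_≟_; any?; toℕ<n; toℕ-fromℕ<; fromℕ<-injective; toℕ-injective; injective⇒≤)
open import Data.List using (List; []; _∷_; length; lookup)
open import Data.List.Membership.Propositional using (_∈_; _∉_)
import Data.List.Membership.DecPropositional as DecMembership
open import Data.List.Membership.Propositional.Properties using (∈-lookup)
open import Data.List.Relation.Unary.Any using (here; there)
open import Data.Nat using (ℕ; zero; suc; _+_; _∸_; _≤_; _<_; z≤n; s≤s; _<?_)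
open import Data.Nat.Induction using (<-wellFounded; <-rec)
open import Data.Nat.Properties hiding (_≟_)
open import Data.Product using (∃; ∃-syntax; _×_; _,_; proj₁; proj₂; swap)
open import Data.Sum using (_⊎_; inj₁; inj₂)
open import Data.Unit using (⊤; tt)
open import Function using (_∘_)
open import Function.Bundles using (_⇔_; mk⇔; Equivalence)
open import Function.Definitions using (Injective)
open import Induction.WellFounded using (Acc; acc)
open import Relation.Binary using (tri<; tri≈; tri>)
open import Relation.Binary.PropositionalEquality using (_≡_; _≢_; refl; sym; trans; cong; subst; subst₂; ≢-sym)
open import Relation.Nullary using (¬_; Dec; yes; no)
open import Relation.Nullary.Decidable using (_×-dec_; ¬?; decidable-stable)

-- Finite sets and parity

least : ∀ {n} (f : Fin n → ℕ) {P : Fin n → Set} → (∀ x → Dec (P x)) → ∃ P →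
        ∃ λ x → P x × (∀ {y} → P y → f x ≤ f y)
least f {P} P? (x , px) = descend x px (<-wellFounded (f x))
  where
  descend : ∀ x → P x → Acc _<_ (f x) → ∃ λ x → P x × (∀ {y} → P y → f x ≤ f y)
  descend x px (acc rec) with any? (λ y → P? y ×-dec (f y <? f x))
  ... | yes (y , py , y<x) = descend y py (rec y<x)
  ... | no none = x , px , λ {y} py → ≮⇒≥ λ y<x → none (y , py , y<x)

-- A missed value `y` could serve as the image of one more element, giving an injection of
-- `Fin (suc n)` into `Fin n`.
injective⇒surjective : ∀ {n} {f : Fin n → Fin n} → Injective _≡_ _≡_ f → ∀ y → ∃ λ x → f x ≡ y
injective⇒surjective {n} {f} inj y with any? (λ x → f x ≟ y)
... | yes found = found
... | no none = ⊥-elim (<-irrefl refl (injective⇒≤ {f = f⁺} f⁺-injective))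
  where
  f⁺ : Fin (suc n) → Fin n
  f⁺ zero    = y
  f⁺ (suc x) = f x
  f⁺-injective : Injective _≡_ _≡_ f⁺
  f⁺-injective {zero}  {zero}  eq = refl
  f⁺-injective {zero}  {suc x} eq = ⊥-elim (none (x , sym eq))
  f⁺-injective {suc x} {zero}  eq = ⊥-elim (none (x , eq))
  f⁺-injective {suc x} {suc z} eq = cong suc (inj eq)

halve : ∀ m → ∃ λ j → m ≡ j + j ⊎ m ≡ suc (j + j)
halve zero = 0 , inj₁ refl
halve (suc m) with halve m
... | j , inj₁ refl = j , inj₂ refl
... | j , inj₂ refl = suc j , inj₁ (cong suc (sym (+-suc j j)))

-- The pan relation

PanE-sym : ∀ {k i j} → PanE k i j → PanE k j i
PanE-sym (inj₁ (p , q , inj₁ r))               = inj₁ (q , p , inj₂ (inj₁ r))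
PanE-sym (inj₁ (p , q , inj₂ (inj₁ r)))        = inj₁ (q , p , inj₁ r)
PanE-sym (inj₁ (p , q , inj₂ (inj₂ (inj₁ r)))) = inj₁ (q , p , inj₂ (inj₂ (inj₂ r)))
PanE-sym (inj₁ (p , q , inj₂ (inj₂ (inj₂ r)))) = inj₁ (q , p , inj₂ (inj₂ (inj₁ r)))
PanE-sym (inj₂ (inj₁ (p , q)))                 = inj₂ (inj₂ (q , p))
PanE-sym (inj₂ (inj₂ (p , q)))                 = inj₂ (inj₁ (q , p))

PanE-irrefl : ∀ {k} → 3 ≤ k → ∀ {i} → ¬ PanE k i i
PanE-irrefl _ (inj₁ (_ , _ , inj₁ r))        = 1+n≢n r
PanE-irrefl _ (inj₁ (_ , _ , inj₂ (inj₁ r))) = 1+n≢n r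
PanE-irrefl 3≤k (inj₁ (_ , _ , inj₂ (inj₂ (inj₁ (p , q))))) =
  <⇒≢ (≤-trans (s≤s (s≤s z≤n)) 3≤k) (trans (cong suc (sym p)) q)
PanE-irrefl 3≤k (inj₁ (_ , _ , inj₂ (inj₂ (inj₂ (p , q))))) =
  <⇒≢ (≤-trans (s≤s (s≤s z≤n)) 3≤k) (trans (cong suc (sym p)) q)
PanE-irrefl 3≤k (inj₂ (inj₁ (p , q))) = <⇒≢ (≤-trans (s≤s z≤n) 3≤k) (trans (sym q) p)
PanE-irrefl 3≤k (inj₂ (inj₂ (p , q))) = <⇒≢ (≤-trans (s≤s z≤n) 3≤k) (trans (sym p) q)

module _ {n : ℕ} (G : Graph n) where

  open Graph G using (adj)

  private
    V : Set
    V = Fin n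
    variable
      S T : V → Set
      k m : ℕ
      u v w x y z : V

  E? : ∀ x y → Dec (E G x y)
  E? x y = adj x y Bool.≟ true

  E-sym : E G x y → E G y x
  E-sym {x} {y} e = trans (Graph.sym G y x) e

  E⇒≢ : E G x y → x ≢ y
  E⇒≢ {x} e refl with trans (sym e) (Graph.irrefl G x)
  ... | ()

  -- Walks

  data Walk (S : V → Set) : ℕ → V → V → Set where
    stop : S u → Walk S 0 u u
    go   : S u → E G u v → Walk S m v w → Walk S (suc m) u w

  infixr 5 _⁀_

  _⁀_ : Walk S m u v → Walk S k v w → Walk S (m + k) u w
  stop _    ⁀ q = q
  go s e p  ⁀ q = go s e (p ⁀ q)

  extend : Walk S m u v → E G v w → S w → Walk S (suc m) u w
  extend (stop s)   e t = go s e (stop t)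
  extend (go s f p) e t = go s f (extend p e t)

  source : Walk S m u v → S u
  source (stop s)   = s
  source (go s _ _) = s

  target : Walk S m u v → S v
  target (stop s)   = s
  target (go _ _ p) = target p

  reverse : Walk S m u v → Walk S m v u
  reverse (stop s)   = stop s
  reverse (go s e p) = extend (reverse p) (E-sym e) s

  mapʷ : (∀ {x} → S x → T x) → Walk S m u v → Walk T m u v
  mapʷ f (stop s)   = stop (f s)
  mapʷ f (go s e p) = go (f s) e (mapʷ f p)

  toWalkIn : Walk S m u v → WalkIn G S u v
  toWalkIn (stop s)   = here s
  toWalkIn (go s e p) = step s e (toWalkIn p)

  fromWalkIn : WalkIn G S u v → ∃ λ m → Walk S m u v
  fromWalkIn (here s) = 0 , stop s
  fromWalkIn (step s e p) with fromWalkIn p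
  ... | m , q = suc m , go s e q

  proper : Walk S m u v → u ≢ v → 1 ≤ m
  proper (stop _)   u≢v = ⊥-elim (u≢v refl)
  proper (go _ _ _) _   = s≤s z≤n

  -- Constant beyond the end, so that no bound has to be carried along.
  at : Walk S m u v → ℕ → V
  at {u = u} _          zero    = u
  at {u = u} (stop _)   (suc _) = u
  at         (go _ _ p) (suc i) = at p i

  at-end : (p : Walk S m u v) → at p m ≡ v
  at-end (stop _)   = refl
  at-end (go _ _ p) = at-end p

  take : (p : Walk S m u v) (i : ℕ) → i ≤ m → Walk S i u (at p i)
  take p          zero    _       = stop (source p)
  take (go s e p) (suc i) (s≤s h) = go s e (take p i h)

  drop : (p : Walk S m u v) (i : ℕ) → i ≤ m → Walk S (m ∸ i) (at p i) v
  drop p          zero    _       = p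
  drop (go s e p) (suc i) (s≤s h) = drop p i h

  at-E : (p : Walk S m u v) (i : ℕ) → i < m → E G (at p i) (at p (suc i))
  at-E (go s e p) zero    _       = e
  at-E (go s e p) (suc i) (s≤s h) = at-E p i h

  Shortest : Walk S m u v → Set
  Shortest {S} {m} {u} {v} _ = ∀ {k} → k < m → ¬ Walk S k u v

  shortest-tail : {s : S u} {e : E G u v} {p : Walk S m v w} → Shortest (go s e p) → Shortest p
  shortest-tail {s = s} {e} sh k<m q = sh (s≤s k<m) (go s e q)

  -- The part of the walk between two equal vertices could be cut out.
  shortest-distinct : (p : Walk S m u v) → Shortest p → ∀ {i j} → i < j → j ≤ m → at p i ≢ at p j
  shortest-distinct p sh {zero} {suc j} _ j<m eq =
    sh (∸-monoʳ-< {o = 0} (s≤s z≤n) j<m) (subst (λ x → Walk _ _ x _) (sym eq) (drop p (suc j) j<m))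
  shortest-distinct (go s e p) sh {suc i} {suc j} (s≤s i<j) (s≤s j≤m) =
    shortest-distinct p (shortest-tail {s = s} {e} {p} sh) i<j j≤m

  -- A chord that skips a vertex would be a shortcut within `S`.
  shortest-chordless : (p : Walk S m u v) → Shortest p → ∀ {i j} → i < j → j ≤ m →
                       E G (at p i) (at p j) → suc i ≡ j
  shortest-chordless p sh {zero} {suc zero} _ _ _ = refl
  shortest-chordless {m = suc m} p sh {zero} {suc (suc j)} _ (s≤s j<m) e =
    ⊥-elim (sh (s≤s (∸-monoʳ-< {o = 0} (s≤s z≤n) j<m))
               (go (source p) e (drop p (suc (suc j)) (s≤s j<m))))
  shortest-chordless (go s e p) sh {suc i} {suc j} (s≤s i<j) (s≤s j≤m) =
    cong suc ∘ shortest-chordless p (shortest-tail {s = s} {e} {p} sh) i<j j≤m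

  -- Configurations

  Avoiding : V → V → V → Set
  Avoiding b c x = x ≢ b × x ≢ c

  record Config (ℓ : ℕ) : Set where
    constructor config
    field
      {a b c d} : V
      ac   : E G a c
      ¬ab  : ¬ E G a b
      a≢b  : a ≢ b
      db   : E G d b
      dc   : E G d c
      b≢c  : b ≢ c
      walk : Walk (Avoiding b c) ℓ d a

  -- Here `w`, `x`, `z`, `y` serve as `b`, `d`, `c`, `a`, and the walk is the edge `xy`. Whether `w`
  -- is adjacent to `z` is left open.
  triangle⇒config : E G x y → E G y z → E G x z → E G w x → ¬ E G w y → w ≢ y → Config 1
  triangle⇒config {x} {y} {z} {w} xy yz xz wx ¬wy w≢y =
    config yz (¬wy ∘ E-sym) (≢-sym w≢y) (E-sym wx) xz (λ { refl → ¬wy (E-sym yz) })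
      (go (≢-sym (E⇒≢ wx) , E⇒≢ xz) xy (stop (≢-sym w≢y , E⇒≢ yz)))

  flip : ∀ {ℓ a b c d} → E G a b → ¬ E G a c → E G d b → E G d c → b ≢ c →
         Walk (Avoiding b c) ℓ d a → Config ℓ
  flip ab ¬ac db dc b≢c p =
    config ab ¬ac (proj₂ (target p)) dc db (≢-sym b≢c) (mapʷ swap p)

  module Minimal {ℓ : ℕ} (C : Config ℓ) (minimal : ∀ {k} → k < ℓ → ¬ Config k) where

    open Config C

    d≢a : d ≢ a
    d≢a refl = ¬ab db

    1≤ℓ : 1 ≤ ℓ
    1≤ℓ = proper walk d≢a

    -- Otherwise `a` would be adjacent to `c` but not to `b` in the triangle `c`, `b`, `d`, a
    -- configuration of length 1.
    bc-nonadjacent : 1 < ℓ → ¬ E G c b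
    bc-nonadjacent 1<ℓ cb = minimal 1<ℓ (triangle⇒config cb (E-sym db) (E-sym dc) ac ¬ab a≢b)

    -- A common neighbour yields a configuration of length 1 if `k` is 1, and of length 2 if `k` is
    -- larger; either is below `ℓ`.
    no-common-neighbour : ∀ {e} → Walk (Avoiding b c) k d e → k < ℓ → e ≢ d → E G e b → ¬ E G e c
    no-common-neighbour (stop _) _ e≢d _ _ = e≢d refl
    no-common-neighbour (go _ de (stop _)) 1<ℓ _ eb ec =
      -- In the triangle `d`, `b`, `e`, the vertex `c` is adjacent to `d` but not to `b`.
      minimal 1<ℓ (triangle⇒config db (E-sym eb) de (E-sym dc) (bc-nonadjacent 1<ℓ) (≢-sym b≢c))
    no-common-neighbour (go _ _ (go _ _ _)) k<ℓ e≢d eb ec =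
      -- The path `a`, `c`, `d`, `b` together with the walk `c`, `e`, `b`.
      minimal (≤-trans (s≤s (s≤s (s≤s z≤n))) k<ℓ)
        (config (E-sym db) (¬ab ∘ E-sym) (≢-sym a≢b) (E-sym ac) (E-sym dc) (≢-sym d≢a)
          (go (E⇒≢ (E-sym ac) , E⇒≢ (E-sym dc)) (E-sym ec)
            (go ((λ { refl → ¬ab eb }) , e≢d) eb
              (stop (≢-sym a≢b , E⇒≢ (E-sym db))))))

    -- If `e` is adjacent to `b` only, it replaces `a` in a shorter configuration with `b` and `c`
    -- exchanged.
    near-b : ∀ {e} → Walk (Avoiding b c) k d e → k < ℓ → e ≢ d → ¬ E G e b
    near-b {e = e} p k<ℓ e≢d eb with E? e c
    ... | yes ec = no-common-neighbour p k<ℓ e≢d eb ec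
    ... | no ¬ec = minimal k<ℓ (flip eb ¬ec db dc b≢c p)

    near-c : ∀ {e} → Walk (Avoiding b c) k d e → k < ℓ → e ≢ d → ¬ E G e c
    near-c {e = e} p k<ℓ e≢d ec with E? e b
    ... | yes eb = no-common-neighbour p k<ℓ e≢d eb ec
    ... | no ¬eb = minimal k<ℓ (config ec ¬eb (proj₁ (target p)) db dc b≢c p)

    shortest : Shortest walk
    shortest k<ℓ p = minimal k<ℓ (config ac ¬ab a≢b db dc b≢c p)

    avoiding : ∀ {i} → i ≤ ℓ → Avoiding b c (at walk i)
    avoiding i≤ℓ = target (take walk _ i≤ℓ)

    at≢d : ∀ {i} → suc i ≤ ℓ → at walk (suc i) ≢ d
    at≢d i<ℓ = ≢-sym (shortest-distinct walk shortest (s≤s z≤n) i<ℓ)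

    b-neighbour : ∀ {i} → i ≤ ℓ → E G (at walk i) b → i ≡ 0
    b-neighbour {zero}  _   _ = refl
    b-neighbour {suc i} i≤ℓ e with m≤n⇒m<n∨m≡n i≤ℓ
    ... | inj₁ i<ℓ  = ⊥-elim (near-b (take walk _ i≤ℓ) i<ℓ (at≢d i≤ℓ) e)
    ... | inj₂ refl = ⊥-elim (¬ab (subst (λ x → E G x b) (at-end walk) e))

    c-neighbour : ∀ {i} → i ≤ ℓ → E G (at walk i) c → i ≡ 0 ⊎ i ≡ ℓ
    c-neighbour {zero}  _   _ = inj₁ refl
    c-neighbour {suc i} i≤ℓ e with m≤n⇒m<n∨m≡n i≤ℓ
    ... | inj₁ i<ℓ  = ⊥-elim (near-c (take walk _ i≤ℓ) i<ℓ (at≢d i≤ℓ) e)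
    ... | inj₂ i≡ℓ  = inj₂ i≡ℓ

  -- Pans and diamonds in minimal configurations

  inducedCopy : {H : Fin m → Fin m → Set} (f : Fin m → V) →
                (∀ {i j} → H i j → H j i) → (∀ {i} → ¬ H i i) →
                (∀ {i j} → toℕ i < toℕ j → f i ≢ f j × (E G (f i) (f j) → H i j) × (H i j → E G (f i) (f j))) →
                InducedCopy G m H
  -- Both relations are symmetric and irreflexive, so the pairs with `i` below `j` decide
  -- everything.
  inducedCopy {m} {H} f H-sym H-irrefl h = f , inj , λ i j → mk⇔ (to i j) (from i j)
    where
    inj : Injective _≡_ _≡_ f
    inj {i} {j} eq with <-cmp (toℕ i) (toℕ j)
    ... | tri< i<j _ _ = ⊥-elim (proj₁ (h i<j) eq)
    ... | tri≈ _ i≡j _ = toℕ-injective i≡j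
    ... | tri> _ _ j<i = ⊥-elim (proj₁ (h j<i) (sym eq))
    to : ∀ i j → E G (f i) (f j) → H i j
    to i j e with <-cmp (toℕ i) (toℕ j)
    ... | tri< i<j _ _ = proj₁ (proj₂ (h i<j)) e
    ... | tri≈ _ i≡j _ = ⊥-elim (E⇒≢ e (cong f (toℕ-injective i≡j)))
    ... | tri> _ _ j<i = H-sym (proj₁ (proj₂ (h j<i)) (E-sym e))
    from : ∀ i j → H i j → E G (f i) (f j)
    from i j e with <-cmp (toℕ i) (toℕ j)
    ... | tri< i<j _ _ = proj₂ (proj₂ (h i<j)) e
    ... | tri≈ _ i≡j _ = ⊥-elim (H-irrefl (subst (H i) (sym (toℕ-injective i≡j)) e))
    ... | tri> _ _ j<i = E-sym (proj₂ (proj₂ (h j<i)) (H-sym e))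

  diamond : E G x y → E G x z → E G x w → E G y z → E G y w → ¬ E G z w → z ≢ w →
            InducedCopy G 4 DiamondE
  diamond {x} {y} {z} {w} xy xz xw yz yw ¬zw z≢w =
    inducedCopy f (λ (i≢j , h) → ≢-sym i≢j , λ { (inj₁ (p , q)) → h (inj₂ (q , p)) ; (inj₂ (p , q)) → h (inj₁ (q , p)) })
      (λ h → proj₁ h refl) pairs
    where
    f : Fin 4 → V
    f 0F = x
    f 1F = y
    f 2F = z
    f 3F = w
    pairs : ∀ {i j} → toℕ i < toℕ j →
            f i ≢ f j × (E G (f i) (f j) → DiamondE i j) × (DiamondE i j → E G (f i) (f j))
    pairs {0F} {1F} _ = E⇒≢ xy , (λ _ → (λ ()) , λ { (inj₁ (() , _)) ; (inj₂ (() , _)) }) , λ _ → xy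
    pairs {0F} {2F} _ = E⇒≢ xz , (λ _ → (λ ()) , λ { (inj₁ (() , _)) ; (inj₂ (() , _)) }) , λ _ → xz
    pairs {0F} {3F} _ = E⇒≢ xw , (λ _ → (λ ()) , λ { (inj₁ (() , _)) ; (inj₂ (() , _)) }) , λ _ → xw
    pairs {1F} {2F} _ = E⇒≢ yz , (λ _ → (λ ()) , λ { (inj₁ (() , _)) ; (inj₂ (() , _)) }) , λ _ → yz
    pairs {1F} {3F} _ = E⇒≢ yw , (λ _ → (λ ()) , λ { (inj₁ (() , _)) ; (inj₂ (() , _)) }) , λ _ → yw
    pairs {2F} {3F} _ = z≢w , (λ zw → ⊥-elim (¬zw zw)) , λ h → ⊥-elim (proj₂ h (inj₁ (refl , refl)))
    pairs {1F} {1F} (s≤s ())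
    pairs {2F} {1F} (s≤s ())
    pairs {2F} {2F} (s≤s (s≤s ()))
    pairs {3F} {1F} (s≤s ())
    pairs {3F} {2F} (s≤s (s≤s ()))
    pairs {3F} {3F} (s≤s (s≤s (s≤s ())))

  module _ {ℓ : ℕ} (C : Config ℓ) (minimal : ∀ {k} → k < ℓ → ¬ Config k) where

    open Config C
    open Minimal C minimal

    private
      -- The cycle runs from `d` along the walk to `a` and closes through `c`, so it has length
      -- `2 + ℓ`, and the pendant `b` hangs at index 0. As a relation, it lets pairs of vertices be
      -- treated by matching.
      data Place : ℕ → V → Set where
        path    : ∀ {i} → i ≤ ℓ → Place i (at walk i)
        apex    : Place (suc ℓ) c
        pendant : Place (suc (suc ℓ)) b

      place : ∀ i → i < 3 + ℓ → ∃ (Place i)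
      place i (s≤s i≤2+ℓ) with m≤n⇒m<n∨m≡n i≤2+ℓ
      ... | inj₂ refl = b , pendant
      ... | inj₁ (s≤s i≤1+ℓ) with m≤n⇒m<n∨m≡n i≤1+ℓ
      ...   | inj₂ refl = c , apex
      ...   | inj₁ (s≤s i≤ℓ) = at walk i , path i≤ℓ

      vertex : Fin (3 + ℓ) → V
      vertex i = proj₁ (place (toℕ i) (toℕ<n i))

      panE-suc : ∀ {i j : Fin (3 + ℓ)} → suc (toℕ i) ≡ toℕ j → toℕ j < 2 + ℓ → PanE (2 + ℓ) i j
      panE-suc eq j<k = inj₁ (≤-trans (s≤s (≤-trans (n≤1+n _) (≤-reflexive eq))) j<k , j<k , inj₁ eq)

      pairs : ¬ E G c b → ∀ {i j : Fin (3 + ℓ)} {x y} → Place (toℕ i) x → Place (toℕ j) y → toℕ i < toℕ j →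
              x ≢ y × (E G x y → PanE (2 + ℓ) i j)
      pairs ¬cb p q i<j = byPlace p q refl refl i<j
        where
        -- Indices are tied to `toℕ i` and `toℕ j` only by equations, so that matching on places can
        -- unify them.
        byPlace : ∀ {i j : Fin (3 + ℓ)} {i′ j′ x y} → Place i′ x → Place j′ y → toℕ i ≡ i′ → toℕ j ≡ j′ → i′ < j′ →
                 x ≢ y × (E G x y → PanE (2 + ℓ) i j)
        byPlace {i} {j} (path i≤ℓ) (path j≤ℓ) refl refl i<j = shortest-distinct walk shortest i<j j≤ℓ ,
          λ e → panE-suc (shortest-chordless walk shortest i<j j≤ℓ e) (s≤s (m≤n⇒m≤1+n j≤ℓ))
        byPlace {i} {j} (path i≤ℓ) apex refl j≡ _ = proj₂ (avoiding i≤ℓ) , λ e → case (c-neighbour i≤ℓ e)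
          where
          case : toℕ i ≡ 0 ⊎ toℕ i ≡ ℓ → PanE (2 + ℓ) i j
          case (inj₂ i≡ℓ) = panE-suc (trans (cong suc i≡ℓ) (sym j≡)) (≤-reflexive (cong suc j≡))
          case (inj₁ i≡0) = inj₁ (s≤s (m≤n⇒m≤1+n i≤ℓ) , ≤-reflexive (cong suc j≡) , inj₂ (inj₂ (inj₁ (i≡0 , cong suc j≡))))
        byPlace (path i≤ℓ) pendant refl j≡ _ = proj₁ (avoiding i≤ℓ) , λ e → inj₂ (inj₂ (b-neighbour i≤ℓ e , j≡))
        byPlace apex (path j≤ℓ) _ _ i<j = ⊥-elim (<-irrefl refl (≤-trans i<j (m≤n⇒m≤1+n j≤ℓ)))
        byPlace apex apex _ _ i<j = ⊥-elim (<-irrefl refl i<j)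
        byPlace apex pendant _ _ _ = ≢-sym b≢c , λ cb → ⊥-elim (¬cb cb)
        byPlace pendant (path j≤ℓ) _ _ i<j = ⊥-elim (<-irrefl refl (≤-trans i<j (m≤n⇒m≤1+n (m≤n⇒m≤1+n j≤ℓ))))
        byPlace pendant apex _ _ i<j = ⊥-elim (<-irrefl refl (≤-trans i<j (n≤1+n _)))
        byPlace pendant pendant _ _ i<j = ⊥-elim (<-irrefl refl i<j)

      place-unique : ∀ {i} → Place i x → Place i y → x ≡ y
      place-unique p q = unique p q refl
        where
        unique : ∀ {i j} → Place i x → Place j y → i ≡ j → x ≡ y
        unique (path _) (path _) refl = refl
        unique (path h) apex refl = ⊥-elim (<-irrefl refl h)
        unique (path h) pendant refl = ⊥-elim (<-irrefl refl (≤-trans (n≤1+n _) h))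
        unique apex (path h) refl = ⊥-elim (<-irrefl refl h)
        unique apex apex _ = refl
        unique apex pendant ()
        unique pendant (path h) refl = ⊥-elim (<-irrefl refl (≤-trans (n≤1+n _) h))
        unique pendant apex ()
        unique pendant pendant _ = refl

      consecutive : ∀ {i} → suc i < 2 + ℓ → Place i x → Place (suc i) y → E G x y
      consecutive {i = i} (s≤s (s≤s i≤ℓ)) p q with m≤n⇒m<n∨m≡n i≤ℓ
      ... | inj₁ i<ℓ  = subst₂ (E G) (place-unique (path i≤ℓ) p) (place-unique (path i<ℓ) q) (at-E walk i i<ℓ)
      ... | inj₂ refl = subst₂ (E G) (trans (sym (at-end walk)) (place-unique (path i≤ℓ) p)) (place-unique apex q) ac

      edges : ∀ {i j : Fin (3 + ℓ)} {x y} → Place (toℕ i) x → Place (toℕ j) y → toℕ i < toℕ j →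
              PanE (2 + ℓ) i j → E G x y
      edges {y = y} p q i<j (inj₁ (_ , j<k , inj₁ eq)) =
        consecutive (subst (_< 2 + ℓ) (sym eq) j<k) p (subst (λ j → Place j y) (sym eq) q)
      edges p q i<j (inj₁ (_ , _ , inj₂ (inj₁ eq))) = ⊥-elim (<-asym i<j (≤-reflexive eq))
      edges {x = x} {y} p q i<j (inj₁ (_ , _ , inj₂ (inj₂ (inj₁ (i≡0 , 1+j≡k))))) =
        subst₂ (E G) (place-unique (path z≤n) (subst (λ i → Place i x) i≡0 p))
                     (place-unique apex (subst (λ j → Place j y) (suc-injective 1+j≡k) q)) dc
      edges p q i<j (inj₁ (_ , _ , inj₂ (inj₂ (inj₂ (j≡0 , _))))) = ⊥-elim (n≮0 (subst (_ <_) j≡0 i<j))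
      edges p q i<j (inj₂ (inj₁ (_ , j≡0))) = ⊥-elim (n≮0 (subst (_ <_) j≡0 i<j))
      edges {x = x} {y} p q i<j (inj₂ (inj₂ (i≡0 , j≡k))) =
        subst₂ (E G) (place-unique (path z≤n) (subst (λ i → Place i x) i≡0 p))
                     (place-unique pendant (subst (λ j → Place j y) j≡k q)) db

    pan : ¬ E G c b → InducedCopy G (3 + ℓ) (PanE (2 + ℓ))
    pan ¬cb = inducedCopy vertex PanE-sym (PanE-irrefl (s≤s (s≤s 1≤ℓ))) λ {i} {j} i<j →
      let p = proj₂ (place (toℕ i) (toℕ<n i)) ; q = proj₂ (place (toℕ j) (toℕ<n j)) in
      proj₁ (pairs ¬cb p q i<j) , proj₂ (pairs ¬cb p q i<j) , edges p q i<j

    minimal-not-free : ¬ PanDiamondFree G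
    minimal-not-free (pan-free , diamond-free) with E? c b | m≤n⇒m<n∨m≡n 1≤ℓ
    ... | no ¬cb | _          = pan-free (2 + ℓ) (s≤s (s≤s 1≤ℓ)) (pan ¬cb)
    ... | yes cb | inj₁ 1<ℓ   = bc-nonadjacent 1<ℓ cb
    -- The walk is now the edge `da`, so `d` and `c` are adjacent to each other and to both `a` and
    -- `b`.
    ... | yes cb | inj₂ 1≡ℓ = diamond-free (diamond dc da db (E-sym ac) cb ¬ab a≢b)
      where
      da : E G d a
      da = subst (E G d) (trans (cong (at walk) 1≡ℓ) (at-end walk)) (at-E walk 0 1≤ℓ)

  -- Strong induction on the length.
  config-free : (∀ {ℓ} → Config ℓ → (∀ {k} → k < ℓ → ¬ Config k) → ⊥) → ∀ {ℓ} → ¬ Config ℓ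
  config-free h {ℓ} = <-rec (λ ℓ → ¬ Config ℓ) (λ ℓ ih C → h C ih) ℓ

  free⇒config-free : PanDiamondFree G → ∀ {ℓ} → ¬ Config ℓ
  free⇒config-free free = config-free λ C minimal → minimal-not-free C minimal free

  -- Configurations in pans and diamonds

  config-free⇒free : (∀ {ℓ} → ¬ Config ℓ) → PanDiamondFree G
  config-free⇒free none = no-pan , no-diamond
    where
    no-diamond : ¬ InducedCopy G 4 DiamondE
    no-diamond (f , inj , h) =
      -- Vertices 2, 3, 1, 0 are `a`, `b`, `c`, `d`, and the walk is the edge from 0 to 2.
      none (config (edge 2F 1F (λ ()) λ { (inj₁ (_ , ())) ; (inj₂ (() , _)) })
                   (λ e → proj₂ (Equivalence.to (h 2F 3F) e) (inj₁ (refl , refl)))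
                   (distinct λ ())
                   (edge 0F 3F (λ ()) λ { (inj₁ (() , _)) ; (inj₂ (() , _)) })
                   (edge 0F 1F (λ ()) λ { (inj₁ (() , _)) ; (inj₂ (() , _)) })
                   (distinct λ ())
                   (go (distinct (λ ()) , distinct (λ ()))
                       (edge 0F 2F (λ ()) λ { (inj₁ (() , _)) ; (inj₂ (() , _)) })
                       (stop (distinct (λ ()) , distinct (λ ())))))
      where
      edge : ∀ i j → i ≢ j → ¬ ((toℕ i ≡ 2 × toℕ j ≡ 3) ⊎ (toℕ i ≡ 3 × toℕ j ≡ 2)) → E G (f i) (f j)
      edge i j i≢j ¬ij = Equivalence.from (h i j) (i≢j , ¬ij)
      distinct : ∀ {i j} → i ≢ j → f i ≢ f j
      distinct i≢j = i≢j ∘ inj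

    no-pan : ∀ k → 3 ≤ k → ¬ InducedCopy G (suc k) (PanE k)
    no-pan (suc (suc (suc t))) (s≤s (s≤s (s≤s z≤n))) (f , inj , h) =
      -- The pendant is `b`; the walk goes from 0 to 2 the long way round the cycle, avoiding 1.
      none (config {a = g 2 2≤K} {b = g K ≤-refl} {c = g 1 1≤K} {d = g 0 z≤n}
             (edge 2≤K 1≤K (inj₁ (s≤s 2≤2+t , s≤s (s≤s z≤n) , inj₂ (inj₁ refl))))
             ¬ab
             (distinct 2≤K ≤-refl λ ())
             (edge z≤n ≤-refl (inj₂ (inj₂ (refl , refl))))
             (edge z≤n 1≤K (inj₁ (s≤s z≤n , s≤s (s≤s z≤n) , inj₁ refl)))
             (distinct ≤-refl 1≤K λ ())
             (go (distinct z≤n ≤-refl (λ ()) , distinct z≤n 1≤K λ ())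
                 (edge z≤n (n≤1+n _) (inj₁ (s≤s z≤n , ≤-refl , inj₂ (inj₂ (inj₁ (refl , refl))))))
                 (down t (n≤1+n _) ≤-refl)))
      where
      K = 3 + t
      1≤K : 1 ≤ K
      1≤K = s≤s z≤n
      2≤2+t : 2 ≤ 2 + t
      2≤2+t = s≤s (s≤s z≤n)
      2≤K : 2 ≤ K
      2≤K = s≤s (s≤s z≤n)
      -- `PanE` on naturals, where `toℕ (fromℕ< _)` can be replaced by substitution.
      Pan′ : ℕ → ℕ → Set
      Pan′ i j = (i < K × j < K × (suc i ≡ j ⊎ suc j ≡ i ⊎ (i ≡ 0 × suc j ≡ K) ⊎ (j ≡ 0 × suc i ≡ K)))
               ⊎ (i ≡ K × j ≡ 0) ⊎ (i ≡ 0 × j ≡ K)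
      g : ∀ i → i ≤ K → V
      g i i≤K = f (fromℕ< (s≤s i≤K))
      distinct : ∀ {i j} i≤K j≤K → i ≢ j → g i i≤K ≢ g j j≤K
      distinct i≤K j≤K i≢j eq = i≢j (fromℕ<-injective _ _ (s≤s i≤K) (s≤s j≤K) (inj eq))
      edge : ∀ {i j} i≤K j≤K → Pan′ i j → E G (g i i≤K) (g j j≤K)
      edge i≤K j≤K p = Equivalence.from (h _ _)
        (subst₂ Pan′ (sym (toℕ-fromℕ< (s≤s i≤K))) (sym (toℕ-fromℕ< (s≤s j≤K))) p)
      ¬ab : ¬ E G (g 2 2≤K) (g K ≤-refl)
      ¬ab e with subst₂ Pan′ (toℕ-fromℕ< (s≤s 2≤K)) (toℕ-fromℕ< (s≤s (≤-refl {K}))) (Equivalence.to (h _ _) e)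
      ... | inj₁ (_ , K<K , _) = <-irrefl refl K<K
      ... | inj₂ (inj₁ (_ , ()))
      ... | inj₂ (inj₂ (() , _))
      down : ∀ i (h : 2 + i ≤ K) → 2 + i < K → Walk (Avoiding (g K ≤-refl) (g 1 1≤K)) i (g (2 + i) h) (g 2 2≤K)
      down zero    h lt = stop (distinct h ≤-refl (<⇒≢ lt) , distinct h 1≤K λ ())
      down (suc i) h lt = go (distinct h ≤-refl (<⇒≢ lt) , distinct h 1≤K λ ())
        (edge h (≤-trans (n≤1+n _) h) (inj₁ (lt , ≤-trans (n≤1+n _) lt , inj₂ (inj₁ refl))))
        (down i (≤-trans (n≤1+n _) h) (≤-trans (n≤1+n _) lt))

  -- Orderings as lists, the most recently visited vertex first: the rank of a vertex
  -- is the length of the list behind it, so it does not change when the list grows.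

  private
    variable
      R : V → List V → Set
      l L : List V

  _∈?_ : (v : V) (l : List V) → Dec (v ∈ l)
  _∈?_ = DecMembership._∈?_ _≟_

  rank : List V → V → ℕ
  rank []      _ = 0
  rank (x ∷ l) v with v ≟ x
  ... | yes _ = length l
  ... | no  _ = rank l v

  rank-here : ∀ x l → rank (x ∷ l) x ≡ length l
  rank-here x l with x ≟ x
  ... | yes _  = refl
  ... | no x≢x = ⊥-elim (x≢x refl)

  rank-there : ∀ l → v ≢ x → rank (x ∷ l) v ≡ rank l v
  rank-there {v} {x} l v≢x with v ≟ x
  ... | yes v≡x = ⊥-elim (v≢x v≡x)
  ... | no  _   = refl

  rank<length : v ∈ l → rank l v < length l
  rank<length {v} {x ∷ l} h with v ≟ x | h
  ... | yes _   | _         = n<1+n _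
  ... | no v≢x | here v≡x  = ⊥-elim (v≢x v≡x)
  ... | no _   | there v∈l = m≤n⇒m≤1+n (rank<length v∈l)

  rank<rank-here : ∀ l → v ∈ (x ∷ l) → v ≢ x → rank (x ∷ l) v < rank (x ∷ l) x
  rank<rank-here l (here v≡x) v≢x = ⊥-elim (v≢x v≡x)
  rank<rank-here {v} {x} l (there v∈l) v≢x rewrite rank-here x l | rank-there l v≢x = rank<length v∈l

  rank-injective : u ∈ l → v ∈ l → rank l u ≡ rank l v → u ≡ v
  rank-injective {u} {x ∷ l} {v} hu hv eq with u ≟ x | v ≟ x | hu | hv
  ... | yes u≡x | yes v≡x | _ | _ = trans u≡x (sym v≡x)
  ... | yes _ | no v≢x | _ | here v≡x = ⊥-elim (v≢x v≡x)
  ... | yes _ | no _ | _ | there v∈l = ⊥-elim (<⇒≢ (rank<length v∈l) (sym eq))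
  ... | no u≢x | _ | here u≡x | _ = ⊥-elim (u≢x u≡x)
  ... | no _ | yes _ | there u∈l | _ = ⊥-elim (<⇒≢ (rank<length u∈l) eq)
  ... | no _ | no v≢x | there u∈l | here v≡x = ⊥-elim (v≢x v≡x)
  ... | no _ | no _ | there u∈l | there v∈l = rank-injective u∈l v∈l eq

  infix 4 _⊑_

  -- Suffixes, that is, earlier stages of the same search.
  data _⊑_ : List V → List V → Set where
    ⊑-refl : l ⊑ l
    ⊑-step : l ⊑ L → l ⊑ x ∷ L

  ⊑-length : l ⊑ L → length l ≤ length L
  ⊑-length ⊑-refl     = ≤-refl
  ⊑-length (⊑-step p) = m≤n⇒m≤1+n (⊑-length p)

  ⊑-∈ : l ⊑ L → v ∈ l → v ∈ L
  ⊑-∈ ⊑-refl     h = h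
  ⊑-∈ (⊑-step p) h = there (⊑-∈ p h)

  ⊑-tail : x ∷ l ⊑ L → l ⊑ L
  ⊑-tail ⊑-refl     = ⊑-step ⊑-refl
  ⊑-tail (⊑-step p) = ⊑-step (⊑-tail p)

  since : v ∈ L → ∃ λ l → v ∷ l ⊑ L
  since (here refl) = _ , ⊑-refl
  since (there h) with since h
  ... | l , p = l , ⊑-step p

  -- `R v l` is the rule under which `v` may follow the visited vertices `l`.
  data Search (R : V → List V → Set) : List V → Set where
    start : ∀ s → Search R (s ∷ [])
    visit : v ∉ l → (∃ λ p → p ∈ l × E G p v) → R v l → Search R l → Search R (v ∷ l)

  search-⊑ : Search R L → v ∷ l ⊑ L → Search R (v ∷ l)
  search-⊑ S                 ⊑-refl     = S
  search-⊑ (visit _ _ _ S) (⊑-step p) = search-⊑ S p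

  search-tail : Search R (v ∷ l) → u ∈ l → Search R l
  search-tail (visit _ _ _ S) _ = S

  search-map : ∀ {R R′ : V → List V → Set} → (∀ {v l} → R v l → R′ v l) → Search R l → Search R′ l
  search-map f (start s)         = start s
  search-map f (visit v∉l p r S) = visit v∉l p (f r) (search-map f S)

  some-visited : Search R l → ∃ (_∈ l)
  some-visited (start s)       = s , here refl
  some-visited (visit _ _ _ _) = _ , here refl

  rank-⊑ : Search R L → l ⊑ L → v ∈ l → rank L v ≡ rank l v
  rank-⊑ _ ⊑-refl _ = refl
  rank-⊑ (start s) (⊑-step ⊑-refl) ()
  rank-⊑ {L = x ∷ L} (visit x∉L _ _ S) (⊑-step p) v∈l =
    trans (rank-there L (λ { refl → x∉L (⊑-∈ p v∈l) })) (rank-⊑ S p v∈l)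

  rank-∉ : Search R L → l ⊑ L → v ∈ L → v ∉ l → length l ≤ rank L v
  rank-∉ _ ⊑-refl v∈L v∉l = ⊥-elim (v∉l v∈L)
  rank-∉ {L = x ∷ L} _ (⊑-step p) (here refl) _ = ≤-trans (⊑-length p) (≤-reflexive (sym (rank-here x L)))
  rank-∉ {L = x ∷ L} (visit x∉L _ _ S) (⊑-step p) (there v∈L) v∉l =
    ≤-trans (rank-∉ S p v∈L v∉l) (≤-reflexive (sym (rank-there L (λ { refl → x∉L v∈L }))))

  rank-since : Search R L → v ∷ l ⊑ L → rank L v ≡ length l
  rank-since {v = v} {l} S p = trans (rank-⊑ S p (here refl)) (rank-here v l)

  ∈⇒before : Search R L → v ∷ l ⊑ L → u ∈ l → rank L u < rank L v
  ∈⇒before S p u∈l rewrite rank-since S p | rank-⊑ S (⊑-tail p) u∈l = rank<length u∈l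

  before⇒∈ : Search R L → v ∷ l ⊑ L → u ∈ L → rank L u < rank L v → u ∈ l
  before⇒∈ {v = v} {l} {u} S p u∈L u<v with u ∈? l
  ... | yes u∈l = u∈l
  ... | no  u∉l = ⊥-elim (<⇒≱ u<v (≤-trans (≤-reflexive (rank-since S p)) (rank-∉ S (⊑-tail p) u∈L u∉l)))

  length≤n : Search R l → length l ≤ n
  length≤n S = injective⇒≤ (lookup-injective S)
    where
    lookup-injective : ∀ {l} → Search R l → Injective _≡_ _≡_ (lookup l)
    lookup-injective (start s) {zero} {zero} _ = refl
    lookup-injective (visit _ _ _ S) {zero} {zero} _ = refl
    lookup-injective (visit v∉l _ _ S) {zero} {suc j} eq = ⊥-elim (v∉l (subst (_∈ _) (sym eq) (∈-lookup j)))
    lookup-injective (visit v∉l _ _ S) {suc i} {zero} eq = ⊥-elim (v∉l (subst (_∈ _) eq (∈-lookup i)))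
    lookup-injective (visit v∉l _ _ S) {suc i} {suc j} eq = cong suc (lookup-injective S eq)

  Extensible : (V → List V → Set) → Set
  Extensible R = ∀ {l u} → Search R l → u ∉ l → ∃ λ v → v ∉ l × (∃ λ p → p ∈ l × E G p v) × R v l

  complete : Extensible R → Search R l → ∃ λ L → l ⊑ L × Search R L × (∀ v → v ∈ L)
  complete {R} ext S = grow n S (m≤n+m n _)
    where
    -- `fuel` bounds the number of unvisited vertices, as searches never repeat a vertex.
    grow : ∀ fuel {l} → Search R l → n ≤ length l + fuel → ∃ λ L → l ⊑ L × Search R L × (∀ v → v ∈ L)
    grow fuel {l} S n≤ with any? (λ v → ¬? (v ∈? l))
    ... | no none = l , ⊑-refl , S , λ v → decidable-stable (v ∈? l) (λ v∉l → none (v , v∉l))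
    ... | yes (u , u∉l) with ext S u∉l
    grow zero {l} S n≤ | yes _ | v , v∉l , p , r =
      ⊥-elim (<⇒≱ (length≤n (visit v∉l p r S)) (subst (n ≤_) (+-identityʳ (length l)) n≤))
    grow (suc fuel) {l} S n≤ | yes _ | v , v∉l , p , r
      with grow fuel (visit v∉l p r S) (subst (n ≤_) (+-suc (length l) fuel) n≤)
    ... | L , p⊑ , S′ , all = L , ⊑-tail p⊑ , S′ , all

  -- Orderings from complete searches

  module Full {R : V → List V → Set} {L : List V} (S : Search R L) (all : ∀ v → v ∈ L) where

    r : V → ℕ
    r = rank L

    r-injective : r u ≡ r v → u ≡ v
    r-injective = rank-injective (all _) (all _)

    position : V → Fin n
    position v = fromℕ< (<-≤-trans (rank<length (all v)) (length≤n S))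

    position-injective : Injective _≡_ _≡_ position
    position-injective eq = r-injective (fromℕ<-injective _ _ _ _ eq)

    σ : Ordering G
    σ = permutation (λ i → proj₁ (onto i)) position
          (λ v → position-injective (proj₂ (onto (position v)))) (λ i → proj₂ (onto i))
      where onto = injective⇒surjective position-injective

    pos-r : ∀ v → toℕ (pos G σ v) ≡ r v
    pos-r v = toℕ-fromℕ< _

    σ⇒r : toℕ (pos G σ u) < toℕ (pos G σ v) → r u < r v
    σ⇒r = subst₂ _<_ (pos-r _) (pos-r _)

    r⇒σ : r u < r v → toℕ (pos G σ u) < toℕ (pos G σ v)
    r⇒σ = subst₂ _<_ (sym (pos-r _)) (sym (pos-r _))

    visited : r u < r v → ∃ λ l → v ∷ l ⊑ L × u ∈ l × (∃ λ p → p ∈ l × E G p v) × R v l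
    visited {u} {v} u<v with since (all v)
    ... | l , p with search-⊑ S p | before⇒∈ S p (all u) u<v
    ...   | start _             | ()
    ...   | visit _ prev rule _ | u∈l = l , p , u∈l , prev , rule

    predecessor : ∀ v → r v ≡ 0 ⊎ ∃ λ p → E G p v × r p < r v
    predecessor v with since (all v)
    ... | l , p with search-⊑ S p
    ...   | start _                      = inj₁ (rank-since S p)
    ...   | visit _ (q , q∈l , qv) _ _ = inj₂ (q , qv , ∈⇒before S p q∈l)

    -- Within a prefix, every vertex leads back through ever earlier predecessors to the vertex of
    -- rank 0.
    isSearch : IsSearch G σ
    isSearch k u v u<k v<k with toRoot u u<k (<-wellFounded _) | toRoot v v<k (<-wellFounded _)
      where
      Prefix : V → Set
      Prefix v = toℕ (pos G σ v) < k
      toRoot : ∀ v → Prefix v → Acc _<_ (r v) → ∃ λ s → r s ≡ 0 × ∃ λ m → Walk Prefix m v s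
      toRoot v v<k (acc rec) with predecessor v
      ... | inj₁ r≡0 = v , r≡0 , 0 , stop v<k
      ... | inj₂ (p , pv , p<v) with toRoot p (<-trans (r⇒σ p<v) v<k) (rec p<v)
      ...   | s , r≡0 , m , q = s , r≡0 , suc m , go v<k (E-sym pv) q
    ... | s , rs , _ , p | t , rt , _ , q with r-injective {s} {t} (trans rs (sym rt))
    ...   | refl = toWalkIn (p ⁀ reverse q)

  -- Extending DFS and BFS searches

  module _ (connected : Connected G) where

    frontier : Search R l → u ∉ l → ∃ λ x → x ∈ l × ∃ λ y → y ∉ l × E G x y
    frontier {l = l} {u} S u∉l = let (x , x∈l) = some-visited S in cross x∈l (connected x u tt tt)
      where
      cross : ∀ {x} → x ∈ l → WalkIn G (λ _ → ⊤) x u → ∃ λ x → x ∈ l × ∃ λ y → y ∉ l × E G x y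
      cross x∈l (here _) = ⊥-elim (u∉l x∈l)
      cross {x} x∈l (step {v = y} _ xy p) with y ∈? l
      ... | yes y∈l = cross y∈l p
      ... | no  y∉l = x , x∈l , y , y∉l , xy

    -- One selection step for both searches: `f` ranks the visited vertices that still have
    -- unvisited neighbours, and `τ` ranks the unvisited neighbours of the chosen one.
    extremal : (f : V → ℕ) (τ : V → ℕ) → Search R l → u ∉ l →
               ∃ λ x → x ∈ l × (∀ {a c} → a ∈ l → c ∉ l → E G a c → f x ≤ f a) ×
               ∃ λ v → v ∉ l × E G x v × (∀ {c} → c ∉ l → E G x c → τ v ≤ τ c)
    extremal {l = l} f τ S u∉l
      with least f {λ x → x ∈ l × ∃ λ y → y ∉ l × E G x y}
             (λ x → (x ∈? l) ×-dec any? (λ y → ¬? (y ∈? l) ×-dec E? x y))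
             (frontier S u∉l)
    ... | x , (x∈l , y) , f-min
      with least τ {λ y → y ∉ l × E G x y} (λ y → ¬? (y ∈? l) ×-dec E? x y) y
    ...   | v , (v∉l , xv) , τ-min =
      x , x∈l , (λ a∈l c∉l ac → f-min (a∈l , _ , c∉l , ac)) , v , v∉l , xv , λ c∉l xc → τ-min (c∉l , xc)

  -- The DFS condition at the moment `v` is visited: `c ∉ l` expresses that `c` comes later, so only
  -- the past matters.
  DFSRule : V → List V → Set
  DFSRule v l = ∀ {a c} → a ∈ l → c ∉ l → E G a c → ¬ E G a v →
                ∃ λ d → d ∈ l × E G d v × rank l a < rank l d

  -- Ties between vertices with the same earliest neighbour are broken by τ.
  BFSRule : (V → ℕ) → V → List V → Set
  BFSRule τ v l = ∀ {a c} → a ∈ l → c ∉ l → E G a c →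
                  ∃ λ d → d ∈ l × E G d v × (rank l d < rank l a ⊎ d ≡ a × τ v ≤ τ c)

  dfs-extensible : Connected G → Extensible DFSRule
  -- Minimising this difference selects the most recent visited vertex with an unvisited neighbour.
  dfs-extensible connected {l} S u∉l with extremal connected (λ x → length l ∸ rank l x) (λ _ → 0) S u∉l
  ... | x , x∈l , newest , v , v∉l , xv , _ = v , v∉l , (x , x∈l , xv) , rule
    where
    rule : DFSRule v l
    rule {a} a∈l c∉l ac ¬av = x , x∈l , xv ,
      ≤∧≢⇒< (∸-cancelʳ-≤ (<⇒≤ (rank<length a∈l)) (newest a∈l c∉l ac))
             (λ eq → ¬av (subst (λ y → E G y v) (sym (rank-injective a∈l x∈l eq)) xv))

  bfs-extensible : Connected G → ∀ τ → Extensible (BFSRule τ)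
  bfs-extensible connected τ {l} S u∉l with extremal connected (rank l) τ S u∉l
  ... | x , x∈l , oldest , v , v∉l , xv , τ-min = v , v∉l , (x , x∈l , xv) , rule
    where
    rule : BFSRule τ v l
    rule a∈l c∉l ac with m≤n⇒m<n∨m≡n (oldest a∈l c∉l ac)
    ... | inj₁ x<a = x , x∈l , xv , inj₁ x<a
    ... | inj₂ eq with rank-injective x∈l a∈l eq
    ...   | refl = x , x∈l , xv , inj₂ (refl , τ-min c∉l ac)

  module _ {L : List V} (S : Search DFSRule L) (all : ∀ v → v ∈ L) where
    open Full S all

    isDFS : IsDFS G σ
    isDFS = isSearch , λ a b c a<b b<c ac ¬ab →
      let (l , p , a∈l , _ , rule) = visited (σ⇒r a<b)
          c∉l = λ c∈l → <-asym (σ⇒r b<c) (∈⇒before S p c∈l)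
          (d , d∈l , db , a<d) = rule a∈l c∉l ac ¬ab
          p′ = ⊑-tail p
      in d , r⇒σ (subst₂ _<_ (sym (rank-⊑ S p′ a∈l)) (sym (rank-⊑ S p′ d∈l)) a<d) , r⇒σ (∈⇒before S p d∈l) , db

  module _ {τ : V → ℕ} {L : List V} (S : Search (BFSRule τ) L) (all : ∀ v → v ∈ L) where
    open Full S all

    bfs-rule : ∀ {a v c} → r a < r v → r v < r c → E G a c →
               ∃ λ d → E G d v × (r d < r a ⊎ d ≡ a × τ v ≤ τ c)
    bfs-rule a<v v<c ac with visited a<v
    ... | l , p , a∈l , _ , rule with rule a∈l (λ c∈l → <-asym v<c (∈⇒before S p c∈l)) ac
    ...   | d , d∈l , dv , inj₁ d<a = d , dv ,
              inj₁ (subst₂ _<_ (sym (rank-⊑ S (⊑-tail p) d∈l)) (sym (rank-⊑ S (⊑-tail p) a∈l)) d<a)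
    ...   | d , d∈l , dv , inj₂ h = d , dv , inj₂ h

    isBFS : IsBFS G σ
    isBFS = isSearch , λ a b c a<b b<c ac ¬ab → earlier ¬ab (bfs-rule (σ⇒r a<b) (σ⇒r b<c) ac)
      where
      earlier : ∀ {a b} {t : Set} → ¬ E G a b → (∃ λ d → E G d b × (r d < r a ⊎ d ≡ a × t)) →
                ∃ λ d → toℕ (pos G σ d) < toℕ (pos G σ a) × E G d b
      earlier ¬ab (d , db , inj₁ d<a)        = d , r⇒σ d<a , db
      earlier ¬ab (d , db , inj₂ (refl , _)) = ⊥-elim (¬ab db)

  -- Depth-first orderings

  -- With the most recent vertex first, this visits the walk from its target to its source.
  toList : Walk S m u v → List V
  toList {u = u} (stop _)   = u ∷ []
  toList {u = u} (go _ _ p) = u ∷ toList p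

  toList-at : (p : Walk S m u v) → x ∈ toList p → ∃ λ i → i ≤ m × x ≡ at p i
  toList-at (stop _)   (here eq) = 0 , z≤n , eq
  toList-at (go _ _ p) (here eq) = 0 , z≤n , eq
  toList-at (go _ _ p) (there h) with toList-at p h
  ... | i , i≤m , eq = suc i , s≤s i≤m , eq

  source∈toList : (p : Walk S m u v) → u ∈ toList p
  source∈toList (stop _)   = here refl
  source∈toList (go _ _ _) = here refl

  target∈toList : (p : Walk S m u v) → v ∈ toList p
  target∈toList (stop _)   = here refl
  target∈toList (go _ _ p) = there (target∈toList p)

  -- The newest vertex `u` is adjacent to `x` and so serves as witness against every older `a`.
  visit-adjacent : (p : Walk S m u v) → x ∉ toList p → E G u x →
                   Search DFSRule (toList p) → Search DFSRule (x ∷ toList p)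
  visit-adjacent {u = u} {x = x} p x∉p ux = visit x∉p (u , source∈toList p , ux) λ a∈p _ _ ¬ax →
    u , source∈toList p , ux , newest p a∈p (λ { refl → ¬ax ux })
    where
    newest : ∀ {a} (p : Walk S m u v) → a ∈ toList p → a ≢ u → rank (toList p) a < rank (toList p) u
    newest (stop _)   = rank<rank-here []
    newest (go _ _ p) = rank<rank-here (toList p)

  shortest-search : (p : Walk S m u v) → Shortest p → Search DFSRule (toList p)
  shortest-search (stop _) _ = start _
  shortest-search (go {u = u} s e p) sh =
    visit-adjacent p u∉p (E-sym e) (shortest-search p (shortest-tail {s = s} {e} {p} sh))
    where
    u∉p : u ∉ toList p
    u∉p u∈p with toList-at p u∈p
    ... | i , i≤m , eq = shortest-distinct (go s e p) sh (s≤s z≤n) (s≤s i≤m) eq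

  -- `covered` excludes the witness demanded by LexDFS as well as the one demanded by MNS, so one
  -- ordering refutes both.
  record DFSViolation : Set where
    field
      σ       : Ordering G
      dfs     : IsDFS G σ
      {a b c} : V
      a<b     : _<[_]_ G a σ b
      b<c     : _<[_]_ G b σ c
      ac      : E G a c
      ¬ab     : ¬ E G a b
      covered : ∀ {e} → _<[_]_ G e σ b → E G e b → E G e c

  module _ (connected : Connected G) {ℓ : ℕ} (C : Config ℓ) (minimal : ∀ {k} → k < ℓ → ¬ Config k) where

    open Config C
    open Minimal C minimal

    -- On the walk, `b` has only the neighbour `d`, which is adjacent to `c`; and `c` is still
    -- unvisited when `b` is reached.
    dfs-violation : DFSViolation
    dfs-violation = record
      { σ = σ ; dfs = isDFS search all
      ; a<b = r⇒σ (∈⇒before search prefix (target∈toList walk))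
      ; b<c = r⇒σ (≤-trans (≤-reflexive (cong suc (rank-since search prefix))) (rank-∉ search prefix (all c) c∉))
      ; ac = ac ; ¬ab = ¬ab
      ; covered = λ {e} e<b eb → covered (before⇒∈ search prefix (all e) (σ⇒r e<b)) eb }
      where
      b∉ : b ∉ toList walk
      b∉ h with toList-at walk h
      ... | i , i≤ℓ , eq = proj₁ (avoiding i≤ℓ) (sym eq)
      c∉ : c ∉ b ∷ toList walk
      c∉ (here c≡b) = b≢c (sym c≡b)
      c∉ (there h) with toList-at walk h
      ... | i , i≤ℓ , eq = proj₂ (avoiding i≤ℓ) (sym eq)
      completed = complete (dfs-extensible connected) (visit-adjacent walk b∉ db (shortest-search walk shortest))
      prefix = proj₁ (proj₂ completed)
      search = proj₁ (proj₂ (proj₂ completed))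
      all    = proj₂ (proj₂ (proj₂ completed))
      open Full search all
      covered : ∀ {e} → e ∈ toList walk → E G e b → E G e c
      covered h eb with toList-at walk h
      ... | i , i≤ℓ , refl with b-neighbour i≤ℓ eb
      ...   | refl = dc

  -- Breadth-first orderings

  -- The first position of `x` on the walk, or `m + 1` off the walk; as a tie-breaker it favours the
  -- walk.
  index : Walk S m u v → V → ℕ
  index {u = u} (stop _) x with x ≟ u
  ... | yes _ = 0
  ... | no  _ = 1
  index {u = u} (go _ _ p) x with x ≟ u
  ... | yes _ = 0
  ... | no  _ = suc (index p x)

  index-at : (p : Walk S m u v) → ∀ i → i ≤ m → index p (at p i) ≤ i
  index-at {u = u} (stop _) zero _ with u ≟ u
  ... | yes _  = z≤n
  ... | no u≢u = ⊥-elim (u≢u refl)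
  index-at {u = u} (go _ _ p) zero _ with u ≟ u
  ... | yes _  = z≤n
  ... | no u≢u = ⊥-elim (u≢u refl)
  index-at {u = u} (go _ _ p) (suc i) (s≤s i≤m) with at p i ≟ u
  ... | yes _ = z≤n
  ... | no  _ = s≤s (index-at p i i≤m)

  at-index : (p : Walk S m u v) → index p x ≤ m → at p (index p x) ≡ x
  at-index {u = u} {x = x} (stop _) h with x ≟ u
  ... | yes x≡u = sym x≡u
  at-index {u = u} {x = x} (stop _) () | no _
  at-index {u = u} {x = x} (go _ _ p) h with x ≟ u
  ... | yes x≡u = sym x≡u
  at-index {u = u} {x = x} (go _ _ p) (s≤s h) | no _ = at-index p h

  Anywhere : V → Set
  Anywhere _ = ⊤

  module BFS {τ : V → ℕ} {s : V} {L : List V} (root : s ∷ [] ⊑ L)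
             (search : Search (BFSRule τ) L) (all : ∀ v → v ∈ L) where

    open Full search all

    r-root : r s ≡ 0
    r-root = rank-since search root

    -- Monotonicity of BFS parents. If `x` precedes `u` and `u` precedes `v`, the BFS rule for the
    -- edge `xv` gives `u` a neighbour no later than `x`; if `x` does not precede `u`, any
    -- predecessor of `u` will do.
    earliest-neighbour : u ≢ s → r u ≤ r v → E G x v →
      ∃ λ p → E G p u × r p < r u × (∀ {y} → E G y u → r p ≤ r y) × r p ≤ r x
    earliest-neighbour {u} {v} {x} u≢s u≤v xv with predecessor u
    ... | inj₁ r≡0 = ⊥-elim (u≢s (r-injective (trans r≡0 (sym r-root))))
    ... | inj₂ (q , qu , q<u) with least r (λ y → E? y u) (q , qu)
    ...   | p , pu , p-min = p , pu , <-≤-trans (s≤s (p-min qu)) q<u , p-min , p≤x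
      where
      p≤x : r p ≤ r x
      p≤x with m≤n⇒m<n∨m≡n u≤v
      ... | inj₂ eq = p-min (subst (E G x) (sym (r-injective eq)) xv)
      ... | inj₁ u<v with r x <? r u
      ...   | no x≮u = ≤-trans (p-min qu) (≤-trans (<⇒≤ q<u) (≮⇒≥ x≮u))
      ...   | yes x<u with bfs-rule search all x<u u<v xv
      ...     | d , du , inj₁ d<x        = ≤-trans (p-min du) (<⇒≤ d<x)
      ...     | d , du , inj₂ (refl , _) = p-min du

    NoLaterThan : V → V → Set
    NoLaterThan u x = r x ≤ r u

    mutual
      -- BFS visits vertices by distance from `s`. Following earliest neighbours from `u` keeps pace
      -- with the given walk from `v` and never meets a vertex later than `u`.
      approach : Walk S m v s → r u ≤ r v → ∃ λ k → k ≤ m × Walk (NoLaterThan u) k u s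
      approach {u = u} p u≤v with u ≟ s
      ... | yes refl = 0 , z≤n , stop ≤-refl
      ... | no u≢s with approach-parent p u≤v u≢s
      ...   | q , qu , q<u , k , k<m , w =
        suc k , k<m , go ≤-refl (E-sym qu) (mapʷ (λ h → ≤-trans h (<⇒≤ q<u)) w)

      approach-parent : Walk S m v s → r u ≤ r v → u ≢ s →
        ∃ λ p → E G p u × r p < r u × ∃ λ k → k < m × Walk (NoLaterThan p) k p s
      approach-parent (stop _) u≤s u≢s =
        ⊥-elim (u≢s (r-injective (trans (n≤0⇒n≡0 (≤-trans u≤s (≤-reflexive r-root))) (sym r-root))))
      approach-parent (go _ vv′ w) u≤v u≢s with earliest-neighbour u≢s u≤v (E-sym vv′)
      ... | p , pu , p<u , _ , p≤v′ with approach w p≤v′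
      ...   | k , k≤m , w′ = p , pu , p<u , k , s≤s k≤m , w′

    -- A vertex visited before P (suc i) but after the same parent P i wins the tie, so it
    -- is itself one of P 0, …, P i.
    lead : (P : Walk S m s w) → (∀ x → τ x ≡ index P x) → ∀ i → i ≤ m → r v < r (at P i) →
           ∃ λ k → k < i × Walk Anywhere k v s
    lead P τ≡ zero _ v<s = ⊥-elim (n≮0 (subst (_ <_) r-root v<s))
    lead {v = v} P τ≡ (suc i) i<m v<P with v ≟ s
    ... | yes refl = 0 , s≤s z≤n , stop tt
    ... | no v≢s with earliest-neighbour v≢s (<⇒≤ v<P) (at-E P i i<m)
    ...   | p , pv , p<v , p-min , p≤Pi with m≤n⇒m<n∨m≡n p≤Pi
    ...     | inj₁ p<Pi with lead P τ≡ i (<⇒≤ i<m) p<Pi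
    ...       | k , k<i , w = suc k , s≤s k<i , go tt (E-sym pv) w
    lead {v = v} P τ≡ (suc i) i<m v<P | no v≢s | p , pv , p<v , p-min , p≤Pi | inj₂ eq
      with bfs-rule search all (subst (_< r v) eq p<v) v<P (at-E P i i<m)
    ... | d , dv , inj₁ d<Pi = ⊥-elim (<⇒≱ d<Pi (≤-trans (≤-reflexive (sym eq)) (p-min dv)))
    ... | d , dv , inj₂ (_ , τ≤) = behind (m≤n⇒m<n∨m≡n index≤)
      where
      index≤ : index P v ≤ suc i
      index≤ = ≤-trans (subst₂ _≤_ (τ≡ v) (τ≡ _) τ≤) (index-at P (suc i) i<m)
      at-v : at P (index P v) ≡ v
      at-v = at-index P (≤-trans index≤ i<m)
      behind : index P v < suc i ⊎ index P v ≡ suc i → ∃ λ k → k < suc i × Walk Anywhere k v s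
      behind (inj₁ lt) = index P v , lt ,
        mapʷ (λ _ → tt) (reverse (subst (Walk _ _ s) at-v (take P _ (≤-trans index≤ i<m))))
      behind (inj₂ eq) = ⊥-elim (<⇒≢ v<P (cong r (trans (sym at-v) (cong (at P) eq))))

  -- Together with `db` and `dc`, the last two fields make `d` the earliest neighbour of `b` and of
  -- `c`.
  record BFSStage {ℓ : ℕ} (C : Config ℓ) : Set where
    open Config C
    field
      {τ}     : V → ℕ
      {order} : List V
      search  : Search (BFSRule τ) order
      all     : ∀ v → v ∈ order
      a<b     : rank order a < rank order b
      a<c     : rank order a < rank order c
      first-b : ∀ {e} → rank order e < rank order d → ¬ E G e b
      first-c : ∀ {e} → rank order e < rank order d → ¬ E G e c

  -- BFS from the centre of the walk

  module _ {ℓ : ℕ} (C : Config ℓ) (minimal : ∀ {k} → k < ℓ → ¬ Config k) (j : ℕ) (2j≤ℓ : j + j ≤ ℓ) where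

    open Config C
    open Minimal C minimal

    private
      j≤ℓ : j ≤ ℓ
      j≤ℓ = ≤-trans (m≤m+n j j) 2j≤ℓ

    centre : V
    centre = at walk j

    d→centre : Walk (Avoiding b c) j d centre
    d→centre = take walk j j≤ℓ

    centre→a : Walk (Avoiding b c) (ℓ ∸ j) centre a
    centre→a = drop walk j j≤ℓ

    module _ {τ : V → ℕ} {L : List V} (root : centre ∷ [] ⊑ L)
             (search : Search (BFSRule τ) L) (all : ∀ v → v ∈ L) where

      open Full search all using (r; r-injective)
      open BFS root search all

      -- To be secured by the tie-breaking: a walk from `d` through the centre to `e` is then short
      -- enough for minimality to apply.
      before-d : Set
      before-d = ∀ {e} → r e < r d → ∃ λ k → j + k < ℓ × Walk Anywhere k e centre

      -- Also to be secured by the tie-breaking: as `b` and `c` are farther than `j` from the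
      -- centre, they then cannot precede `a`.
      before-a : Set
      before-a = ∀ {e} → r e < r a → ∃ λ k → k ≤ j × Walk Anywhere k e centre

      avoid : ∀ {p k e} → r p < r b → r p < r c → Walk (NoLaterThan p) k e centre → Walk (Avoiding b c) k e centre
      avoid p<b p<c = mapʷ λ x≤p → (λ { refl → <⇒≱ p<b x≤p }) , (λ { refl → <⇒≱ p<c x≤p })

      -- Here `x` is the earlier of `b` and `c`. Its BFS parent `p` would be nearer than `j` to the
      -- centre. If `p` is `d`, this shortens the walk to `a`; otherwise `p` is reached from `d` in
      -- fewer than `ℓ` steps yet adjacent to `x`.
      first-far : ∀ {x k} → (∀ {k e} → Walk (Avoiding b c) k d e → k < ℓ → e ≢ d → ¬ E G e x) →
                  x ≢ centre → r x ≤ r b → r x ≤ r c → k ≤ j → ¬ Walk S k x centre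
      first-far near x≢s x≤b x≤c k≤j w with approach-parent w ≤-refl x≢s
      ... | p , px , p<x , k′ , k′<k , w′ = contra (p ≟ d)
        where
        w″ : Walk (Avoiding b c) k′ p centre
        w″ = avoid (<-≤-trans p<x x≤b) (<-≤-trans p<x x≤c) w′
        k′<j : k′ < j
        k′<j = <-≤-trans k′<k k≤j
        contra : Dec (p ≡ d) → ⊥
        contra (yes refl) = shortest (subst (k′ + (ℓ ∸ j) <_) (m+[n∸m]≡n j≤ℓ) (+-monoˡ-< (ℓ ∸ j) k′<j)) (w″ ⁀ centre→a)
        contra (no p≢d)   = near (d→centre ⁀ reverse w″) (<-≤-trans (+-monoʳ-< j k′<j) 2j≤ℓ) p≢d px

      -- Of `b` and `c`, the one visited first would be no farther from the centre than the other,
      -- so `first-far` applies to it.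
      far-b : ∀ {k} → k ≤ j → ¬ Walk S k b centre
      far-c : ∀ {k} → k ≤ j → ¬ Walk S k c centre
      far-b k≤j w with ≤-total (r b) (r c)
      ... | inj₁ b≤c = first-far near-b (≢-sym (proj₁ (target d→centre))) ≤-refl b≤c k≤j w
      ... | inj₂ c≤b with approach w c≤b
      ...   | k′ , k′≤k , w′ = first-far near-c (≢-sym (proj₂ (target d→centre))) c≤b ≤-refl (≤-trans k′≤k k≤j) w′
      far-c k≤j w with ≤-total (r c) (r b)
      ... | inj₁ c≤b = first-far near-c (≢-sym (proj₂ (target d→centre))) c≤b ≤-refl k≤j w
      ... | inj₂ b≤c with approach w b≤c
      ...   | k′ , k′≤k , w′ = first-far near-b (≢-sym (proj₁ (target d→centre))) ≤-refl b≤c (≤-trans k′≤k k≤j) w′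

      after : ∀ {x y} → (∀ {k} → k ≤ j → ¬ Walk (NoLaterThan x) k x centre) → Walk S j y centre → r y < r x
      after far w = ≰⇒> λ x≤y → let (k , k≤j , w′) = approach w x≤y in far k≤j w′

      -- The walk from `e` back to the centre uses only vertices before `d`, and `d` precedes `b`
      -- and `c`; prefixed by the walk from `d`, it stays below length `ℓ`.
      first-neighbour : before-d → (∀ {k e} → Walk (Avoiding b c) k d e → k < ℓ → e ≢ d → ¬ E G e x) →
                        ∀ {e} → r e < r d → ¬ E G e x
      first-neighbour h near {e} e<d with h e<d
      ... | k , j+k<ℓ , w with approach w ≤-refl
      ...   | k′ , k′≤k , w′ = near
        (d→centre ⁀ reverse (avoid (<-trans e<d (after far-b d→centre)) (<-trans e<d (after far-c d→centre)) w′))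
        (≤-<-trans (+-monoʳ-≤ j k′≤k) j+k<ℓ) (λ { refl → <-irrefl refl e<d })

      after-a : ∀ {x} → before-a → a ≢ x → (∀ {k} → k ≤ j → ¬ Walk Anywhere k x centre) → r a < r x
      after-a h a≢x far = ≤∧≢⇒< (≮⇒≥ λ x<a → let (k , k≤j , w) = h x<a in far k≤j w) (a≢x ∘ r-injective)

      stage : before-d → before-a → BFSStage C
      stage hd ha = record
        { search = search ; all = all
        ; a<b = after-a ha a≢b far-b ; a<c = after-a ha (E⇒≢ ac) far-c
        ; first-b = first-neighbour hd near-b ; first-c = first-neighbour hd near-c }

  bfs-stage : Connected G → ∀ {ℓ} (C : Config ℓ) → (∀ {k} → k < ℓ → ¬ Config k) → BFSStage C
  bfs-stage connected {ℓ} C minimal with halve ℓ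
  -- Both ends are `j` steps from the centre. Favouring the half to `d` brings everything before `d`
  -- within fewer than `j` steps; for `a` the bound `j` is enough.
  ... | j , inj₁ refl = even
    where
    P = reverse (d→centre C minimal j ≤-refl)
    completed = complete (bfs-extensible connected (index P)) (start (centre C minimal j ≤-refl))
    root   = proj₁ (proj₂ completed)
    search = proj₁ (proj₂ (proj₂ completed))
    all    = proj₂ (proj₂ (proj₂ completed))
    open BFS root search all
    open Full search all using (r)
    even : BFSStage C
    even = stage C minimal j ≤-refl root search all
      (λ {e} e<d → let (k , k<j , w) = lead P (λ _ → refl) j ≤-refl (subst (λ x → r e < r x) (sym (at-end P)) e<d) in
         k , +-monoʳ-< j k<j , w)
      (λ e<a → let (k , k≤ , w) = approach (reverse (centre→a C minimal j ≤-refl)) (<⇒≤ e<a) in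
         k , ≤-trans k≤ (≤-reflexive (m+n∸m≡n j j)) , mapʷ (λ _ → tt) w)
  -- Now `a` is `j + 1` steps away, and favouring its half brings everything before `a` within `j`
  -- steps; for `d` the distance bound `j` already suffices.
  ... | j , inj₂ refl = odd
    where
    P = centre→a C minimal j (n≤1+n _)
    completed = complete (bfs-extensible connected (index P)) (start (centre C minimal j (n≤1+n _)))
    root   = proj₁ (proj₂ completed)
    search = proj₁ (proj₂ (proj₂ completed))
    all    = proj₂ (proj₂ (proj₂ completed))
    open BFS root search all
    open Full search all using (r)
    odd : BFSStage C
    odd = stage C minimal j (n≤1+n _) root search all
      (λ e<d → let (k , k≤j , w) = approach (d→centre C minimal j (n≤1+n _)) (<⇒≤ e<d) in
         k , s≤s (+-monoʳ-≤ j k≤j) , mapʷ (λ _ → tt) w)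
      (λ {e} e<a → let (k , k< , w) = lead P (λ _ → refl) _ ≤-refl (subst (λ x → r e < r x) (sym (at-end P)) e<a) in
         k , ≤-pred (≤-trans k< (≤-reflexive (trans (+-∸-assoc 1 (m≤m+n j j)) (cong suc (m+n∸m≡n j j))))) , w)

  -- LexBFS violations by reordering

  bfs-next : ∀ {d v} → Search (BFSRule (λ _ → 0)) l → v ∉ l → d ∈ l → E G d v →
             (∀ {a c} → a ∈ l → c ∉ l → E G a c → rank l d ≤ rank l a) →
             Search (BFSRule (λ _ → 0)) (v ∷ l)
  bfs-next {l = l} {d} {v} S v∉l d∈l dv oldest = visit v∉l (d , d∈l , dv) rule S
    where
    rule : BFSRule (λ _ → 0) v l
    rule a∈l c∉l ac with m≤n⇒m<n∨m≡n (oldest a∈l c∉l ac)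
    ... | inj₁ d<a = d , d∈l , dv , inj₁ d<a
    ... | inj₂ eq  = d , d∈l , dv , inj₂ (rank-injective d∈l a∈l eq , z≤n)

  module _ (connected : Connected G) (bfs⇒lexbfs : ∀ σ → IsBFS G σ → IsLexBFS G σ) where

    -- In any BFS completion `b` precedes `c`. The LexBFS witness precedes `y`, hence already lies
    -- in `l`.
    prefix-lexbfs : ∀ {b c y} → Search (BFSRule (λ _ → 0)) (b ∷ l) → c ∉ b ∷ l → y ∈ l → E G y c → ¬ E G y b →
                    ∃ λ e → e ∈ l × rank l e < rank l y × E G e b × ¬ E G e c
    prefix-lexbfs {l = l} {b} {c} {y} S c∉ y∈l yc ¬yb =
      let (e , e<y , eb , ¬ec) = proj₂ (bfs⇒lexbfs σ (isBFS search all)) y b c (r⇒σ y<b) (r⇒σ b<c) yc ¬yb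
          e∈l = before⇒∈ search prefix (all e) (<-trans (σ⇒r e<y) y<b)
      in e , e∈l ,
         subst₂ _<_ (rank-⊑ search (⊑-tail prefix) e∈l) (rank-⊑ search (⊑-tail prefix) y∈l) (σ⇒r e<y) , eb , ¬ec
      where
      completed = complete (bfs-extensible connected (λ _ → 0)) S
      prefix = proj₁ (proj₂ completed)
      search = proj₁ (proj₂ (proj₂ completed))
      all    = proj₂ (proj₂ (proj₂ completed))
      open Full search all
      y<b : r y < r b
      y<b = ∈⇒before search prefix y∈l
      b<c : r b < r c
      b<c = ≤-trans (≤-reflexive (cong suc (rank-since search prefix))) (rank-∉ search prefix (all c) c∉)

    module _ {τ : V → ℕ} {L : List V} (S : Search (BFSRule τ) L) (all : ∀ v → v ∈ L) where

      open Full S all using (r; visited)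

      -- The vertices before both b and c are kept and b is moved up to come next.
      differing-neighbour : ∀ {b c d y x} → r x ≤ r b → r x ≤ r c → b ≢ c → E G d b → r d < r x → r y < r x →
        (∀ {e} → r e < r d → ¬ E G e x) → E G y c → ¬ E G y b →
        ∃ λ e → r e < r y × E G e b × ¬ E G e c
      differing-neighbour {b} {c} {d} {y} {x} x≤b x≤c b≢c db d<x y<x first yc ¬yb with visited d<x
      ... | l , p , d∈l , _ , rule =
        let (e , e∈l , e<y , eb , ¬ec) = prefix-lexbfs (bfs-next Sₗ b∉l d∈l db oldest) c∉ y∈l yc ¬yb
        in e , subst₂ _<_ (sym (rank-⊑ S p′ e∈l)) (sym (rank-⊑ S p′ y∈l)) e<y , eb , ¬ec
        where
        p′ = ⊑-tail p
        y∈l = before⇒∈ S p (all y) y<x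
        b∉l : b ∉ l
        b∉l b∈l = <⇒≱ (∈⇒before S p b∈l) x≤b
        c∉ : c ∉ b ∷ l
        c∉ (here c≡b)  = b≢c (sym c≡b)
        c∉ (there c∈l) = <⇒≱ (∈⇒before S p c∈l) x≤c
        -- The tie-breaking is dropped, since `b` need not win it against `x`.
        Sₗ : Search (BFSRule (λ _ → 0)) l
        Sₗ = search-map forget (search-tail (search-⊑ S p) d∈l)
          where
          forget : ∀ {v l} → BFSRule τ v l → BFSRule (λ _ → 0) v l
          forget rule a∈l c∉l ac with rule a∈l c∉l ac
          ... | d , d∈l , dv , inj₁ d<a       = d , d∈l , dv , inj₁ d<a
          ... | d , d∈l , dv , inj₂ (d≡a , _) = d , d∈l , dv , inj₂ (d≡a , z≤n)
        -- After `l` came `x`, so some neighbour `e` of `x` is no later than `a`; and `d` is no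
        -- later than any neighbour of `x`.
        oldest : ∀ {a c} → a ∈ l → c ∉ l → E G a c → rank l d ≤ rank l a
        oldest a∈l c∉l ac with rule a∈l c∉l ac
        ... | e , e∈l , ex , h = ≤-trans
          (subst₂ _≤_ (rank-⊑ S p′ d∈l) (rank-⊑ S p′ e∈l) (≮⇒≥ λ e<d → first e<d ex)) (le h)
          where
          le : ∀ {a e} {t : Set} → rank l e < rank l a ⊎ e ≡ a × t → rank l e ≤ rank l a
          le (inj₁ lt)         = <⇒≤ lt
          le (inj₂ (refl , _)) = ≤-refl

      -- Whichever of `b` and `c` is visited first plays the role of `x`.
      earlier-differing-neighbour : ∀ {b c d y} → b ≢ c → E G d b → r y < r b → r y < r c →
        (∀ {e} → r e < r d → ¬ E G e b) → (∀ {e} → r e < r d → ¬ E G e c) → E G y c → ¬ E G y b →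
        ∃ λ e → r e < r y × E G e b × ¬ E G e c
      earlier-differing-neighbour {b} {c} {d} {y} b≢c db y<b y<c first-b first-c yc ¬yb with ≤-total (r b) (r c)
      ... | inj₁ b≤c = differing-neighbour ≤-refl b≤c b≢c db (≤-<-trans d≤y y<b) y<b first-b yc ¬yb
        where d≤y = ≮⇒≥ λ y<d → first-c y<d yc
      ... | inj₂ c≤b = differing-neighbour c≤b ≤-refl b≢c db (≤-<-trans d≤y y<c) y<c first-c yc ¬yb
        where d≤y = ≮⇒≥ λ y<d → first-c y<d yc

    -- The first vertex `y` that tells `b` from `c` is no later than `a`, so it precedes both. The
    -- LexBFS witness would tell them apart even earlier.
    stage-impossible : ∀ {ℓ} {C : Config ℓ} → ¬ BFSStage C
    stage-impossible {C = C} st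
      with least (rank order) (λ y → ¬? (adj y b Bool.≟ adj y c)) (a , λ eq → ¬ab (trans eq ac))
      where
      open Config C
      open BFSStage st
    ... | y , differs , y-min = contra (E? y b) (E? y c)
      where
      open Config C
      open BFSStage st
      y≤a : rank order y ≤ rank order a
      y≤a = y-min λ eq → ¬ab (trans eq ac)
      agree : ∀ {e} → rank order e < rank order y → adj e b ≡ adj e c
      agree {e} e<y = decidable-stable (adj e b Bool.≟ adj e c) λ ne → <⇒≱ e<y (y-min ne)
      contra : Dec (E G y b) → Dec (E G y c) → ⊥
      contra (yes yb) (yes yc) = differs (trans yb (sym yc))
      contra (no ¬yb) (no ¬yc) = differs (trans (Bool.¬-not ¬yb) (sym (Bool.¬-not ¬yc)))
      contra (no ¬yb) (yes yc) =
        let (e , e<y , eb , ¬ec) = earlier-differing-neighbour search all b≢c db (≤-<-trans y≤a a<b) (≤-<-trans y≤a a<c)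
                                     first-b first-c yc ¬yb
        in ¬ec (trans (sym (agree e<y)) eb)
      contra (yes yb) (no ¬yc) =
        let (e , e<y , ec , ¬eb) = earlier-differing-neighbour search all (≢-sym b≢c) dc (≤-<-trans y≤a a<c) (≤-<-trans y≤a a<b)
                                     first-c first-b yb ¬yc
        in ¬eb (trans (agree e<y) ec)

  -- Lexicographic rules in free graphs

  module _ (free : PanDiamondFree G) where

    -- If `dc` were an edge, a walk in the prefix before `b` would complete a configuration.
    lexicographic : ∀ σ {a b c d} → IsSearch G σ → _<[_]_ G a σ b → _<[_]_ G b σ c → E G a c → ¬ E G a b →
                    _<[_]_ G d σ b → E G d b → ¬ E G d c
    lexicographic σ {a} {b} {c} {d} search a<b b<c ac ¬ab d<b db dc =
      free⇒config-free free (config ac ¬ab (λ { refl → <-irrefl refl a<b }) db dc (λ { refl → <-irrefl refl b<c })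
        (mapʷ (λ x<b → (λ { refl → <-irrefl refl x<b }) , (λ { refl → <-asym b<c x<b })) (proj₂ (fromWalkIn d→a))))
      where
      d→a : WalkIn G (λ x → toℕ (pos G σ x) < toℕ (pos G σ b)) d a
      d→a = search (toℕ (pos G σ b)) d a d<b a<b

    dfs⇒lexdfs : ∀ σ → IsDFS G σ → IsLexDFS G σ
    dfs⇒lexdfs σ (search , rule) = search , λ a b c a<b b<c ac ¬ab →
      let (d , a<d , d<b , db) = rule a b c a<b b<c ac ¬ab
      in d , a<d , d<b , db , lexicographic σ search a<b b<c ac ¬ab d<b db

    bfs⇒lexbfs : ∀ σ → IsBFS G σ → IsLexBFS G σ
    bfs⇒lexbfs σ (search , rule) = search , λ a b c a<b b<c ac ¬ab →
      let (d , d<a , db) = rule a b c a<b b<c ac ¬ab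
      in d , d<a , db , lexicographic σ search a<b b<c ac ¬ab (<-trans d<a a<b) db

    search⇒mns : ∀ σ → IsSearch G σ → IsMNS G σ
    search⇒mns σ search = search , rule
      where
      rule : Rule G σ (λ a b c → ∃[ d ] (_<[_]_ G d σ b × E G d b × ¬ E G d c))
      rule a b c a<b b<c ac ¬ab
        -- The prefix includes `b` itself, so the first step from `b` towards `a` leads to an
        -- earlier neighbour.
        with search (suc (toℕ (pos G σ b))) b a ≤-refl (m≤n⇒m≤1+n a<b)
      ... | here _ = ⊥-elim (<-irrefl refl a<b)
      ... | step {v = d} _ bd w = d , d<b , E-sym bd , lexicographic σ search a<b b<c ac ¬ab d<b (E-sym bd)
        where
        d<b : _<[_]_ G d σ b
        d<b = ≤∧≢⇒< (≤-pred (source (proj₂ (fromWalkIn w))))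
                    (λ eq → E⇒≢ bd (sym (pos-injective (toℕ-injective eq))))
          where
          pos-injective : ∀ {x y} → pos G σ x ≡ pos G σ y → x ≡ y
          pos-injective eq = trans (sym (inverseʳ σ)) (trans (cong (σ ⟨$⟩ʳ_) eq) (inverseʳ σ))

  -- Freeness from the ordering conditions

  module _ (connected : Connected G) where

    dfs⇒lexdfs⇒free : (∀ σ → IsDFS G σ → IsLexDFS G σ) → PanDiamondFree G
    dfs⇒lexdfs⇒free h = config-free⇒free (config-free λ C minimal →
      let open DFSViolation (dfs-violation connected C minimal)
          (d , _ , d<b , db , ¬dc) = proj₂ (h σ dfs) _ _ _ a<b b<c ac ¬ab
      in ¬dc (covered d<b db))

    search⇒mns⇒free : (∀ σ → IsSearch G σ → IsMNS G σ) → PanDiamondFree G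
    search⇒mns⇒free h = config-free⇒free (config-free λ C minimal →
      let open DFSViolation (dfs-violation connected C minimal)
          (d , d<b , db , ¬dc) = proj₂ (h σ (proj₁ dfs)) _ _ _ a<b b<c ac ¬ab
      in ¬dc (covered d<b db))

    bfs⇒lexbfs⇒free : (∀ σ → IsBFS G σ → IsLexBFS G σ) → PanDiamondFree G
    bfs⇒lexbfs⇒free h = config-free⇒free (config-free λ C minimal →
      stage-impossible connected h (bfs-stage connected C minimal))

theorem2 : ∀ (n : ℕ) (G : Graph n) → Connected G →
    (PanDiamondFree G ⇔ (∀ σ → IsDFS G σ → IsLexDFS G σ)) ×
    (PanDiamondFree G ⇔ (∀ σ → IsBFS G σ → IsLexBFS G σ)) ×
    (PanDiamondFree G ⇔ (∀ σ → IsSearch G σ → IsMNS G σ))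
theorem2 n G connected =
  mk⇔ (dfs⇒lexdfs G) (dfs⇒lexdfs⇒free G connected) ,
  mk⇔ (bfs⇒lexbfs G) (bfs⇒lexbfs⇒free G connected) ,
  mk⇔ (search⇒mns G) (search⇒mns⇒free G connected)
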